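{- Let $n<\omega$ and let $\mathcal{K}$ be a class of simple algebras of $\mathbf{M}_n$ such that the variety $\mathbf{V}(\mathcal{K})$ generated by $\mathcal{K}$ is locally finite. Then every finite simple algebra in $\mathbf{V}(\mathcal{K})$ is isomorphic to a subalgebra of a member of $\mathcal{K}$.
   Context: $\mathbf{M}_n$ is the variety of pseudocomplemented de Morgan algebras $(L;\wedge,\vee,{}^\ast,{}^\prime,0,1)$ (bounded distributive lattice, pseudocomplement ${}^\ast$, de Morgan involution ${}^\prime$) satisfying $x\wedge x^{\prime\ast\prime}\le y\vee y^\ast$ and $(x\wedge x^{\prime\ast})^{n(\prime\ast)}=(x\wedge x^{\prime\ast})^{(n+1)(\prime\ast)}$, where $x^{0(\prime\ast)}=x$, $x^{(k+1)(\prime\ast)}=((x^{k(\prime\ast)})')^\ast$. Simple algebras are non-trivial. -}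

module Defs where

open import Level using (Level; _⊔_) renaming (suc to lsuc)
open import Data.Nat.Base using (ℕ; zero; suc)
open import Data.Fin.Base using (Fin)
open import Data.Product.Base using (Σ; ∃; _×_; _,_; proj₁; proj₂)
open import Data.Sum.Base using (_⊎_)
open import Relation.Nullary using (¬_)
open import Relation.Unary using (Pred)
open import Relation.Binary.Core using (Rel; _⇒_)
open import Relation.Binary.Bundles using (Setoid)
open import Relation.Binary.Structures using (IsEquivalence)
import Relation.Binary.PropositionalEquality as ≡
open import Algebra.Core using (Op₁; Op₂)
import Algebra.Definitions as AlgDefs
import Algebra.Lattice.Structures as LatticeStructures
open import Function.Bundles using (Bijection)
open import Function.Definitions using (Congruent; Surjective; Bijective)

private
  variable
    ℓ k : Level

-- An algebra of type (∧, ∨, *, ′, 0, 1), subject to no identities.  Underlying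
-- sets are setoids so that quotients exist.  Carrier and equality share one
-- level, so that algebras of level ℓ have products over index sets in Set ℓ.

record Algebra ℓ : Set (lsuc ℓ) where
  infix  4 _≈_ _≤_
  infixr 6 _∨_
  infixr 7 _∧_
  infixl 9 _* _′
  field
    Carrier       : Set ℓ
    _≈_           : Rel Carrier ℓ
    _∧_ _∨_       : Op₂ Carrier
    _* _′         : Op₁ Carrier
    0# 1#         : Carrier
    isEquivalence : IsEquivalence _≈_
    ∧-cong        : AlgDefs.Congruent₂ _≈_ _∧_
    ∨-cong        : AlgDefs.Congruent₂ _≈_ _∨_
    *-cong        : AlgDefs.Congruent₁ _≈_ _*
    ′-cong        : AlgDefs.Congruent₁ _≈_ _′

  setoid : Setoid ℓ ℓ
  setoid = record { isEquivalence = isEquivalence }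

  _≤_ : Rel Carrier ℓ
  x ≤ y = x ∧ y ≈ x

  _^[_′*] : Carrier → ℕ → Carrier
  x ^[ zero  ′*] = x
  x ^[ suc m ′*] = (x ^[ m ′*]) ′ *

record IsPseudocomplementedDeMorgan (A : Algebra ℓ) : Set ℓ where
  open Algebra A
  open AlgDefs _≈_ using (Identity)
  open LatticeStructures _≈_ using (IsDistributiveLattice)
  field
    isDistributiveLattice : IsDistributiveLattice _∨_ _∧_
    ∨-identity            : Identity 0# _∨_
    ∧-identity            : Identity 1# _∧_
    *-disjoint            : ∀ x → x ∧ x * ≈ 0#
    *-greatest            : ∀ x y → x ∧ y ≈ 0# → y ≤ x *
    ′-involutive          : ∀ x → x ′ ′ ≈ x
    ′-deMorgan            : ∀ x y → (x ∧ y) ′ ≈ x ′ ∨ y ′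

record M (n : ℕ) (A : Algebra ℓ) : Set ℓ where
  open Algebra A
  field
    isPseudocomplementedDeMorgan : IsPseudocomplementedDeMorgan A
    regular   : ∀ x y → x ∧ x ′ * ′ ≤ y ∨ y *
    ′*-stable : ∀ x → (x ∧ x ′ *) ^[ n ′*] ≈ (x ∧ x ′ *) ^[ suc n ′*]

record IsCongruence (A : Algebra ℓ) (θ : Rel (Algebra.Carrier A) ℓ) : Set ℓ where
  open Algebra A
  field
    reflexive     : _≈_ ⇒ θ
    isEquivalence : IsEquivalence θ
    ∧-compatible  : AlgDefs.Congruent₂ θ _∧_
    ∨-compatible  : AlgDefs.Congruent₂ θ _∨_
    *-compatible  : AlgDefs.Congruent₁ θ _*
    ′-compatible  : AlgDefs.Congruent₁ θ _′

-- "Exactly two congruences" is stated for arbitrary relations, as in classical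
-- algebra; applied to x ≈ y ⊎ X it makes a simple algebra decide every
-- X : Set ℓ, so no separate excluded-middle assumption is made.

record Simple (A : Algebra ℓ) : Set (lsuc ℓ) where
  open Algebra A
  field
    nontrivial : ∃ λ x → ∃ λ y → ¬ x ≈ y
    Δ-or-∇     : ∀ θ → IsCongruence A θ →
                 (∀ x y → θ x y → x ≈ y) ⊎ (∀ x y → θ x y)

record IsHomomorphism (A B : Algebra ℓ)
                      (f : Algebra.Carrier A → Algebra.Carrier B) : Set ℓ where
  private
    module A = Algebra A
    module B = Algebra B
  field
    cong   : Congruent A._≈_ B._≈_ f
    ∧-homo : ∀ x y → f (x A.∧ y) B.≈ f x B.∧ f y
    ∨-homo : ∀ x y → f (x A.∨ y) B.≈ f x B.∨ f y
    *-homo : ∀ x → f (x A.*) B.≈ f x B.*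
    ′-homo : ∀ x → f (x A.′) B.≈ f x B.′
    0-homo : f A.0# B.≈ B.0#
    1-homo : f A.1# B.≈ B.1#

_↠_ : Algebra ℓ → Algebra ℓ → Set ℓ
A ↠ B = ∃ λ f → IsHomomorphism A B f × Surjective (Algebra._≈_ A) (Algebra._≈_ B) f

_≅_ : Algebra ℓ → Algebra ℓ → Set ℓ
A ≅ B = ∃ λ f → IsHomomorphism A B f × Bijective (Algebra._≈_ A) (Algebra._≈_ B) f

record Subuniverse (A : Algebra ℓ) : Set (lsuc ℓ) where
  open Algebra A
  field
    Member   : Pred Carrier ℓ
    resp     : ∀ {x y} → x ≈ y → Member x → Member y
    ∧-closed : ∀ {x y} → Member x → Member y → Member (x ∧ y)
    ∨-closed : ∀ {x y} → Member x → Member y → Member (x ∨ y)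
    *-closed : ∀ {x} → Member x → Member (x *)
    ′-closed : ∀ {x} → Member x → Member (x ′)
    0-closed : Member 0#
    1-closed : Member 1#

subalgebra : (A : Algebra ℓ) → Subuniverse A → Algebra ℓ
subalgebra A S = record
  { Carrier       = Σ Carrier Member
  ; _≈_           = λ x y → proj₁ x ≈ proj₁ y
  ; _∧_           = λ x y → proj₁ x ∧ proj₁ y , ∧-closed (proj₂ x) (proj₂ y)
  ; _∨_           = λ x y → proj₁ x ∨ proj₁ y , ∨-closed (proj₂ x) (proj₂ y)
  ; _*            = λ x → proj₁ x * , *-closed (proj₂ x)
  ; _′            = λ x → proj₁ x ′ , ′-closed (proj₂ x)
  ; 0#            = 0# , 0-closed
  ; 1#            = 1# , 1-closed
  ; isEquivalence = record { refl = refl ; sym = sym ; trans = trans }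
  ; ∧-cong        = ∧-cong
  ; ∨-cong        = ∨-cong
  ; *-cong        = *-cong
  ; ′-cong        = ′-cong
  }
  where
  open Algebra A
  open Subuniverse S
  open IsEquivalence isEquivalence using (refl; sym; trans)

product : (I : Set ℓ) → (I → Algebra ℓ) → Algebra ℓ
product I B = record
  { Carrier       = ∀ i → Carrier (B i)
  ; _≈_           = λ x y → ∀ i → _≈_ (B i) (x i) (y i)
  ; _∧_           = λ x y i → _∧_ (B i) (x i) (y i)
  ; _∨_           = λ x y i → _∨_ (B i) (x i) (y i)
  ; _*            = λ x i → _* (B i) (x i)
  ; _′            = λ x i → _′ (B i) (x i)
  ; 0#            = λ i → 0# (B i)
  ; 1#            = λ i → 1# (B i)
  ; isEquivalence = record
    { refl  = λ i → IsEquivalence.refl (isEquivalence (B i))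
    ; sym   = λ p i → IsEquivalence.sym (isEquivalence (B i)) (p i)
    ; trans = λ p q i → IsEquivalence.trans (isEquivalence (B i)) (p i) (q i)
    }
  ; ∧-cong        = λ p q i → ∧-cong (B i) (p i) (q i)
  ; ∨-cong        = λ p q i → ∨-cong (B i) (p i) (q i)
  ; *-cong        = λ p i → *-cong (B i) (p i)
  ; ′-cong        = λ p i → ′-cong (B i) (p i)
  }
  where open Algebra

-- The variety generated by K: the least class containing K and closed under
-- homomorphic images (in particular isomorphic copies), subalgebras and
-- direct products.

data V (K : Pred (Algebra ℓ) k) : Pred (Algebra ℓ) (lsuc ℓ ⊔ k) where
  base : ∀ {A} → K A → V K A
  H    : ∀ {A B} → V K A → A ↠ B → V K B
  S    : ∀ {A} → V K A → (U : Subuniverse A) → V K (subalgebra A U)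
  P    : ∀ I (B : I → Algebra ℓ) → (∀ i → V K (B i)) → V K (product I B)

Finite : Algebra ℓ → Set ℓ
Finite A = ∃ λ m → Bijection (≡.setoid (Fin m)) (Algebra.setoid A)

data Generated (A : Algebra ℓ) {m} (g : Fin m → Algebra.Carrier A) :
               Pred (Algebra.Carrier A) ℓ where
  gen  : ∀ i → Generated A g (g i)
  resp : ∀ {x y} → Algebra._≈_ A x y → Generated A g x → Generated A g y
  ∧-closed : ∀ {x y} → Generated A g x → Generated A g y → Generated A g (Algebra._∧_ A x y)
  ∨-closed : ∀ {x y} → Generated A g x → Generated A g y → Generated A g (Algebra._∨_ A x y)
  *-closed : ∀ {x} → Generated A g x → Generated A g (Algebra._* A x)
  ′-closed : ∀ {x} → Generated A g x → Generated A g (Algebra._′ A x)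
  0-closed : Generated A g (Algebra.0# A)
  1-closed : Generated A g (Algebra.1# A)

FinitelyGenerated : Algebra ℓ → Set ℓ
FinitelyGenerated A =
  ∃ λ m → Σ (Fin m → Algebra.Carrier A) λ g → ∀ x → Generated A g x

LocallyFinite : Pred (Algebra ℓ) k → Set (lsuc ℓ ⊔ k)
LocallyFinite W = ∀ A → W A → FinitelyGenerated A → Finite A

-- The operation tables of a finite algebra A, over variables for its elements,
-- form a finite system of equations, and its solutions in B are the
-- homomorphisms A → B.  If A and B are simple such a homomorphism is injective,
-- so it suffices to solve the system in some member of K.  In M n the system is
-- encoded in one term T: by regularity x = y iff x* = y* and x′* = y′*, which
-- is expressed as δ x y = 1 for a term δ, and w = (x ∧ x′*)^n(′*) satisfies
-- w′* = w, hence is a central element with complement w′.  In a simple algebra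
-- w is therefore 0 or 1, and it is 1 only if x = 1.  Let T be the term w applied
-- to the meet of all δ p q.  In a member of K, T is 0 wherever the system fails; in
-- A it is 1 at the tautological assignment.  So if i, j name distinct elements of
-- A, the identity T ∧ i = T ∧ j fails in A, hence at some assignment in some
-- member of K; there T is not 0, and the assignment solves the system.

module Submission where

open import Defs
open import Level using (Level)
open import Axiom.ExcludedMiddle using (ExcludedMiddle)
open import Axiom.DoubleNegationElimination using (em⇒dne)
open import Data.Nat.Base using (ℕ; zero; suc)
open import Data.Fin.Base using (Fin)
open import Data.List.Base using (List; []; _∷_; map; concat; tabulate)
open import Data.List.Relation.Unary.All using (All; []; _∷_)
open import Data.List.Relation.Unary.All.Properties
  using (concat⁺; concat⁻; tabulate⁺; tabulate⁻)
open import Data.Product.Base using (∃; _×_; _,_; proj₁; proj₂)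
open import Data.Sum.Base using (_⊎_; inj₁; inj₂; [_,_]′)
open import Function.Base using (_∘_; id)
open import Function.Bundles using (Bijection)
open import Function.Definitions using (Injective)
open import Relation.Binary.Bundles using (Setoid)
open import Relation.Binary.PropositionalEquality as ≡ using (_≡_)
open import Relation.Nullary using (¬_; yes; no; contradiction)
open import Relation.Unary using (Pred; _⊆_; _∩_)
import Relation.Binary.Reasoning.Setoid as ≈-Reasoning
open import Algebra.Lattice.Structures using (IsDistributiveLattice)

private
  variable
    ℓ k : Level
    m : ℕ
    A B : Algebra ℓ

-- Derived operations on an arbitrary algebra.

module Operations (A : Algebra ℓ) where
  open Algebra A
  open Setoid setoid using (refl)

  infix 8 _∼_

  -- Under the laws of pseudocomplementation its value is 1 exactly when `x * ≈ y *`: the two meets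
  -- vanish exactly when each pseudocomplement lies below the other.
  _∼_ : Carrier → Carrier → Carrier
  x ∼ y = (x ∧ y * ∨ x * ∧ y) *

  δ : Carrier → Carrier → Carrier
  δ x y = x ∼ y ∧ x ′ ∼ y ′

  core : ℕ → Carrier → Carrier
  core n x = (x ∧ x ′ *) ^[ n ′*]

  ⋀δ : List (Carrier × Carrier) → Carrier
  ⋀δ []              = 1#
  ⋀δ ((x , y) ∷ xys) = δ x y ∧ ⋀δ xys

  ∼-congˡ : ∀ {x y z} → y ≈ z → x ∼ y ≈ x ∼ z
  ∼-congˡ p = *-cong (∨-cong (∧-cong refl (*-cong p)) (∧-cong refl p))

  δ-congˡ : ∀ {x y z} → y ≈ z → δ x y ≈ δ x z
  δ-congˡ p = ∧-cong (∼-congˡ p) (∼-congˡ (′-cong p))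

  ^-cong : ∀ n {x y} → x ≈ y → x ^[ n ′*] ≈ y ^[ n ′*]
  ^-cong zero    p = p
  ^-cong (suc n) p = *-cong (′-cong (^-cong n p))

  core-cong : ∀ n {x y} → x ≈ y → core n x ≈ core n y
  core-cong n p = ^-cong n (∧-cong p (*-cong (′-cong p)))

-- Arithmetic of pseudocomplemented de Morgan algebras.

module PseudocomplementedDeMorgan
  (A : Algebra ℓ) (isPDM : IsPseudocomplementedDeMorgan A) where

  open Algebra A
  open Operations A
  open IsPseudocomplementedDeMorgan isPDM
  open IsDistributiveLattice isDistributiveLattice
    using ( ∧-comm; ∧-assoc; ∨-comm; ∨-congʳ; ∨-congˡ; ∧-congʳ; ∧-congˡ
          ; ∨-absorbs-∧; ∧-absorbs-∨; ∧-distribʳ-∨)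
  open Setoid setoid using (refl; sym; trans)
  open ≈-Reasoning setoid

  0∨x≈x : ∀ x → 0# ∨ x ≈ x
  0∨x≈x = proj₁ ∨-identity

  x∨0≈x : ∀ x → x ∨ 0# ≈ x
  x∨0≈x = proj₂ ∨-identity

  1∧x≈x : ∀ x → 1# ∧ x ≈ x
  1∧x≈x = proj₁ ∧-identity

  x∧1≈x : ∀ x → x ∧ 1# ≈ x
  x∧1≈x = proj₂ ∧-identity

  0∧x≈0 : ∀ x → 0# ∧ x ≈ 0#
  0∧x≈0 x = begin
    0# ∧ x         ≈⟨ ∧-congˡ (0∨x≈x x) ⟨
    0# ∧ (0# ∨ x)  ≈⟨ ∧-absorbs-∨ 0# x ⟩
    0#             ∎

  x∧0≈0 : ∀ x → x ∧ 0# ≈ 0#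
  x∧0≈0 x = trans (∧-comm x 0#) (0∧x≈0 x)

  1∨x≈1 : ∀ x → 1# ∨ x ≈ 1#
  1∨x≈1 x = begin
    1# ∨ x         ≈⟨ ∨-congˡ (1∧x≈x x) ⟨
    1# ∨ (1# ∧ x)  ≈⟨ ∨-absorbs-∧ 1# x ⟩
    1#             ∎

  x∨1≈1 : ∀ x → x ∨ 1# ≈ 1#
  x∨1≈1 x = trans (∨-comm x 1#) (1∨x≈1 x)

  ∧-idem : ∀ x → x ∧ x ≈ x
  ∧-idem x = trans (∧-congˡ (sym (x∨0≈x x))) (∧-absorbs-∨ x 0#)

  ≤-antisym : ∀ {x y} → x ≤ y → y ≤ x → x ≈ y
  ≤-antisym {x} {y} x≤y y≤x = trans (sym x≤y) (trans (∧-comm x y) y≤x)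

  x∨y≈0⇒x≈0 : ∀ {x y} → x ∨ y ≈ 0# → x ≈ 0#
  x∨y≈0⇒x≈0 {x} {y} p = begin
    x            ≈⟨ ∧-absorbs-∨ x y ⟨
    x ∧ (x ∨ y)  ≈⟨ ∧-congˡ p ⟩
    x ∧ 0#       ≈⟨ x∧0≈0 x ⟩
    0#           ∎

  x∧y≈1⇒x≈1 : ∀ {x y} → x ∧ y ≈ 1# → x ≈ 1#
  x∧y≈1⇒x≈1 {x} {y} p = begin
    x            ≈⟨ ∨-absorbs-∧ x y ⟨
    x ∨ (x ∧ y)  ≈⟨ ∨-congˡ p ⟩
    x ∨ 1#       ≈⟨ x∨1≈1 x ⟩
    1#           ∎

  x∧y≈1⇒y≈1 : ∀ {x y} → x ∧ y ≈ 1# → y ≈ 1#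
  x∧y≈1⇒y≈1 {x} {y} p = x∧y≈1⇒x≈1 (trans (∧-comm y x) p)

  0*≈1 : 0# * ≈ 1#
  0*≈1 = begin
    0# *       ≈⟨ 1∧x≈x (0# *) ⟨
    1# ∧ 0# *  ≈⟨ *-greatest 0# 1# (0∧x≈0 1#) ⟩
    1#         ∎

  x*≈1⇒x≈0 : ∀ {x} → x * ≈ 1# → x ≈ 0#
  x*≈1⇒x≈0 {x} p = begin
    x        ≈⟨ x∧1≈x x ⟨
    x ∧ 1#   ≈⟨ ∧-congˡ p ⟨
    x ∧ x *  ≈⟨ *-disjoint x ⟩
    0#       ∎

  0′≈1 : 0# ′ ≈ 1#
  0′≈1 = begin
    0# ′             ≈⟨ ′-cong (x∧0≈0 (1# ′)) ⟨
    (1# ′ ∧ 0#) ′    ≈⟨ ′-deMorgan (1# ′) 0# ⟩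
    1# ′ ′ ∨ 0# ′    ≈⟨ ∨-congʳ (′-involutive 1#) ⟩
    1# ∨ 0# ′        ≈⟨ 1∨x≈1 (0# ′) ⟩
    1#               ∎

  1′≈0 : 1# ′ ≈ 0#
  1′≈0 = trans (′-cong (sym 0′≈1)) (′-involutive 0#)

  1′*≈1 : 1# ′ * ≈ 1#
  1′*≈1 = trans (*-cong 1′≈0) 0*≈1

  x′*≈1⇒x≈1 : ∀ {x} → x ′ * ≈ 1# → x ≈ 1#
  x′*≈1⇒x≈1 {x} p = begin
    x      ≈⟨ ′-involutive x ⟨
    x ′ ′  ≈⟨ ′-cong (x*≈1⇒x≈0 p) ⟩
    0# ′   ≈⟨ 0′≈1 ⟩
    1#     ∎

  -- The de Morgan dual of `*-disjoint`; `x ′ * ′` is the dual pseudocomplement of `x`.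
  x∨x′*′≈1 : ∀ x → x ∨ x ′ * ′ ≈ 1#
  x∨x′*′≈1 x = begin
    x ∨ x ′ * ′      ≈⟨ ∨-congʳ (′-involutive x) ⟨
    x ′ ′ ∨ x ′ * ′  ≈⟨ ′-deMorgan (x ′) (x ′ *) ⟨
    (x ′ ∧ x ′ *) ′  ≈⟨ ′-cong (*-disjoint (x ′)) ⟩
    0# ′             ≈⟨ 0′≈1 ⟩
    1#               ∎

  x∼x≈1 : ∀ x → x ∼ x ≈ 1#
  x∼x≈1 x = begin
    (x ∧ x * ∨ x * ∧ x) *  ≈⟨ *-cong (∨-congˡ (∧-comm (x *) x)) ⟩
    (x ∧ x * ∨ x ∧ x *) *  ≈⟨ *-cong (∨-cong (*-disjoint x) (*-disjoint x)) ⟩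
    (0# ∨ 0#) *            ≈⟨ *-cong (0∨x≈x 0#) ⟩
    0# *                   ≈⟨ 0*≈1 ⟩
    1#                     ∎

  x∼y≈1⇒x*≈y* : ∀ {x y} → x ∼ y ≈ 1# → x * ≈ y *
  x∼y≈1⇒x*≈y* {x} {y} p = ≤-antisym
    (*-greatest y (x *) (trans (∧-comm y (x *))
      (x∨y≈0⇒x≈0 (trans (∨-comm (x * ∧ y) (x ∧ y *)) join≈0))))
    (*-greatest x (y *) (x∨y≈0⇒x≈0 join≈0))
    where
    join≈0 : x ∧ y * ∨ x * ∧ y ≈ 0#
    join≈0 = x*≈1⇒x≈0 p

  δ-refl : ∀ x → δ x x ≈ 1#
  δ-refl x = trans (∧-cong (x∼x≈1 x) (x∼x≈1 (x ′))) (1∧x≈x 1#)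

  1^n≈1 : ∀ n → 1# ^[ n ′*] ≈ 1#
  1^n≈1 zero    = refl
  1^n≈1 (suc n) = trans (*-cong (′-cong (1^n≈1 n))) 1′*≈1

  -- Each round can be undone: `y ′ * ≈ 1#` forces `y ′ ≈ 0#`, hence `y ≈ 1#`.
  x^n≈1⇒x≈1 : ∀ n {x} → x ^[ n ′*] ≈ 1# → x ≈ 1#
  x^n≈1⇒x≈1 zero    p = p
  x^n≈1⇒x≈1 (suc n) p = x^n≈1⇒x≈1 n (x′*≈1⇒x≈1 p)

  x≈1⇒core≈1 : ∀ n {x} → x ≈ 1# → core n x ≈ 1#
  x≈1⇒core≈1 n {x} p = begin
    core n x                   ≈⟨ core-cong n p ⟩
    (1# ∧ 1# ′ *) ^[ n ′*]     ≈⟨ ^-cong n (trans (1∧x≈x (1# ′ *)) 1′*≈1) ⟩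
    1# ^[ n ′*]                ≈⟨ 1^n≈1 n ⟩
    1#                         ∎

  core≈1⇒x≈1 : ∀ n {x} → core n x ≈ 1# → x ≈ 1#
  core≈1⇒x≈1 n p = x∧y≈1⇒x≈1 (x^n≈1⇒x≈1 n p)

  module Central {w : Carrier} (w∧w′≈0 : w ∧ w ′ ≈ 0#) where

    _≈ʷ_ : Carrier → Carrier → Set ℓ
    x ≈ʷ y = x ∧ w ≈ y ∧ w

    ∧-relative : ∀ x y → (x ∧ y) ∧ w ≈ (x ∧ w) ∧ (y ∧ w)
    ∧-relative x y = begin
      (x ∧ y) ∧ w        ≈⟨ ∧-congˡ (∧-idem w) ⟨
      (x ∧ y) ∧ (w ∧ w)  ≈⟨ ∧-assoc x y (w ∧ w) ⟩
      x ∧ y ∧ w ∧ w      ≈⟨ ∧-congˡ (∧-assoc y w w) ⟨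
      x ∧ (y ∧ w) ∧ w    ≈⟨ ∧-congˡ (∧-comm (y ∧ w) w) ⟩
      x ∧ w ∧ y ∧ w      ≈⟨ ∧-assoc x w (y ∧ w) ⟨
      (x ∧ w) ∧ y ∧ w    ∎

    -- Centrality enters here: de Morgan turns `(x ∧ w) ′` into `x ′ ∨ w ′`, and the extra joinand
    -- dies when met with `w`.
    ′-relative : ∀ x → x ′ ∧ w ≈ (x ∧ w) ′ ∧ w
    ′-relative x = sym (begin
      (x ∧ w) ′ ∧ w          ≈⟨ ∧-congʳ (′-deMorgan x w) ⟩
      (x ′ ∨ w ′) ∧ w        ≈⟨ ∧-distribʳ-∨ w (x ′) (w ′) ⟩
      x ′ ∧ w ∨ w ′ ∧ w      ≈⟨ ∨-congˡ (trans (∧-comm (w ′) w) w∧w′≈0) ⟩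
      x ′ ∧ w ∨ 0#           ≈⟨ x∨0≈x (x ′ ∧ w) ⟩
      x ′ ∧ w                ∎)

    -- By `*-greatest` it is enough that `y` is disjoint from `x * ∧ w`, and there `y ∧ w` may be
    -- replaced by `x ∧ w`.
    *-relative-≤ : ∀ {x y} → x ≈ʷ y → x * ∧ w ≤ y * ∧ w
    *-relative-≤ {x} {y} p = begin
      (x * ∧ w) ∧ y * ∧ w        ≈⟨ ∧-congˡ (∧-comm (y *) w) ⟩
      (x * ∧ w) ∧ w ∧ y *        ≈⟨ ∧-assoc (x * ∧ w) w (y *) ⟨
      ((x * ∧ w) ∧ w) ∧ y *      ≈⟨ ∧-congʳ (trans (∧-assoc (x *) w w) (∧-congˡ (∧-idem w))) ⟩
      (x * ∧ w) ∧ y *            ≈⟨ *-greatest y (x * ∧ w) disjoint ⟩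
      x * ∧ w                    ∎
      where
      disjoint : y ∧ x * ∧ w ≈ 0#
      disjoint = begin
        y ∧ x * ∧ w      ≈⟨ ∧-congˡ (∧-comm (x *) w) ⟩
        y ∧ w ∧ x *      ≈⟨ ∧-assoc y w (x *) ⟨
        (y ∧ w) ∧ x *    ≈⟨ ∧-congʳ p ⟨
        (x ∧ w) ∧ x *    ≈⟨ ∧-congʳ (∧-comm x w) ⟩
        (w ∧ x) ∧ x *    ≈⟨ ∧-assoc w x (x *) ⟩
        w ∧ x ∧ x *      ≈⟨ ∧-congˡ (*-disjoint x) ⟩
        w ∧ 0#           ≈⟨ x∧0≈0 w ⟩
        0#               ∎

    isCongruence : IsCongruence A _≈ʷ_
    isCongruence = record
      { reflexive     = ∧-congʳ
      ; isEquivalence = record { refl = refl ; sym = sym ; trans = trans }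
      ; ∧-compatible  = λ {x} {y} {u} {v} p q →
          trans (∧-relative x u) (trans (∧-cong p q) (sym (∧-relative y v)))
      ; ∨-compatible  = λ {x} {y} {u} {v} p q →
          trans (∧-distribʳ-∨ w x u) (trans (∨-cong p q) (sym (∧-distribʳ-∨ w y v)))
      ; *-compatible  = λ p → ≤-antisym (*-relative-≤ p) (*-relative-≤ (sym p))
      ; ′-compatible  = λ {x} {y} p →
          trans (′-relative x) (trans (∧-congʳ (′-cong p)) (sym (′-relative y)))
      }

    -- The congruence `_≈ʷ_` always relates `w` to 1. If it is equality, then `w ≈ 1#`; if it is
    -- total, it relates 1 to 0, which says `w ≈ 0#`.
    central-simple : Simple A → w ≈ 0# ⊎ w ≈ 1#
    central-simple simple with Simple.Δ-or-∇ simple _≈ʷ_ isCongruence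
    ... | inj₁ Δ = inj₂ (Δ w 1# (trans (∧-idem w) (sym (1∧x≈x w))))
    ... | inj₂ ∇ = inj₁ (trans (sym (1∧x≈x w)) (trans (∇ 1# 0#) (0∧x≈0 w)))

  simple⇒0≉1 : Simple A → ¬ 0# ≈ 1#
  simple⇒0≉1 simple 0≈1 with x , y , x≉y ← Simple.nontrivial simple =
    x≉y (trans (≈0 x) (sym (≈0 y)))
    where
    ≈0 : ∀ z → z ≈ 0#
    ≈0 z = trans (sym (x∧1≈x z)) (trans (∧-congˡ (sym 0≈1)) (x∧0≈0 z))

-- Consequences of regularity and stability in `M n`.

module RegularStable {n : ℕ} (A : Algebra ℓ) (isM : M n A) where

  open Algebra A
  open Operations A
  open M isM
  open IsPseudocomplementedDeMorgan isPseudocomplementedDeMorgan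
  open PseudocomplementedDeMorgan A isPseudocomplementedDeMorgan
  open IsDistributiveLattice isDistributiveLattice
    using (∧-comm; ∧-assoc; ∨-congˡ; ∧-congʳ; ∧-congˡ; ∧-distribˡ-∨; ∨-absorbs-∧)
  open Setoid setoid using (sym; trans)
  open ≈-Reasoning setoid

  -- Write u⁺ for `u ′ * ′`. Since y ∨ y⁺ = 1 and y⁺ = x⁺, `x` is the join of x ∧ y and x ∧ x⁺.
  -- Regularity puts the latter below y ∨ y*, and x ∧ y* = x ∧ x* = 0 leaves only x ∧ y.
  *-′*-≤ : ∀ {x y} → x * ≈ y * → x ′ * ≈ y ′ * → x ≤ y
  *-′*-≤ {x} {y} p q = sym (begin
    x                              ≈⟨ x∧1≈x x ⟨
    x ∧ 1#                         ≈⟨ ∧-congˡ (x∨x′*′≈1 y) ⟨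
    x ∧ (y ∨ y ′ * ′)              ≈⟨ ∧-distribˡ-∨ x y (y ′ * ′) ⟩
    x ∧ y ∨ x ∧ y ′ * ′            ≈⟨ ∨-congˡ (∧-congˡ (′-cong q)) ⟨
    x ∧ y ∨ x ∧ x ′ * ′            ≈⟨ ∨-congˡ x∧x⁺≤x∧y ⟨
    x ∧ y ∨ (x ∧ x ′ * ′) ∧ x ∧ y  ≈⟨ ∨-congˡ (∧-comm _ _) ⟩
    x ∧ y ∨ (x ∧ y) ∧ x ∧ x ′ * ′  ≈⟨ ∨-absorbs-∧ (x ∧ y) (x ∧ x ′ * ′) ⟩
    x ∧ y                          ∎)
    where
    x∧[y∨y*]≈x∧y : x ∧ (y ∨ y *) ≈ x ∧ y
    x∧[y∨y*]≈x∧y = begin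
      x ∧ (y ∨ y *)      ≈⟨ ∧-distribˡ-∨ x y (y *) ⟩
      x ∧ y ∨ x ∧ y *    ≈⟨ ∨-congˡ (∧-congˡ p) ⟨
      x ∧ y ∨ x ∧ x *    ≈⟨ ∨-congˡ (*-disjoint x) ⟩
      x ∧ y ∨ 0#         ≈⟨ x∨0≈x (x ∧ y) ⟩
      x ∧ y              ∎
    x∧x⁺≤x∧y : x ∧ x ′ * ′ ≤ x ∧ y
    x∧x⁺≤x∧y = begin
      (x ∧ x ′ * ′) ∧ x ∧ y            ≈⟨ ∧-congˡ x∧[y∨y*]≈x∧y ⟨
      (x ∧ x ′ * ′) ∧ x ∧ (y ∨ y *)    ≈⟨ ∧-assoc (x ∧ x ′ * ′) x (y ∨ y *) ⟨
      ((x ∧ x ′ * ′) ∧ x) ∧ (y ∨ y *)  ≈⟨ ∧-congʳ (∧-comm (x ∧ x ′ * ′) x) ⟩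
      (x ∧ x ∧ x ′ * ′) ∧ (y ∨ y *)    ≈⟨ ∧-congʳ (∧-assoc x x (x ′ * ′)) ⟨
      ((x ∧ x) ∧ x ′ * ′) ∧ (y ∨ y *)  ≈⟨ ∧-congʳ (∧-congʳ (∧-idem x)) ⟩
      (x ∧ x ′ * ′) ∧ (y ∨ y *)        ≈⟨ regular x y ⟩
      x ∧ x ′ * ′                      ∎

  δ≈1⇒≈ : ∀ {x y} → δ x y ≈ 1# → x ≈ y
  δ≈1⇒≈ {x} {y} p = ≤-antisym (*-′*-≤ x*≈y* x′*≈y′*) (*-′*-≤ (sym x*≈y*) (sym x′*≈y′*))
    where
    x*≈y* : x * ≈ y *
    x*≈y* = x∼y≈1⇒x*≈y* (x∧y≈1⇒x≈1 p)
    x′*≈y′* : x ′ * ≈ y ′ *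
    x′*≈y′* = x∼y≈1⇒x*≈y* (x∧y≈1⇒y≈1 p)

  -- Stability says that the core c satisfies c = c′*, and c′ is disjoint from its own
  -- pseudocomplement.
  core-central : ∀ x → core n x ∧ core n x ′ ≈ 0#
  core-central x = begin
    core n x ∧ core n x ′      ≈⟨ ∧-comm (core n x) (core n x ′) ⟩
    core n x ′ ∧ core n x      ≈⟨ ∧-congˡ (′*-stable x) ⟩
    core n x ′ ∧ core n x ′ *  ≈⟨ *-disjoint (core n x ′) ⟩
    0#                         ∎

  core≉0⇒x≈1 : Simple A → ∀ {x} → ¬ core n x ≈ 0# → x ≈ 1#
  core≉0⇒x≈1 simple {x} core≉0 with Central.central-simple (core-central x) simple
  ... | inj₁ core≈0 = contradiction core≈0 core≉0
  ... | inj₂ core≈1 = core≈1⇒x≈1 n core≈1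

-- Terms and their evaluation.

infixr 6 _∨ᵗ_
infixr 7 _∧ᵗ_
infixl 9 _*ᵗ _′ᵗ

data Term (ℓ : Level) (m : ℕ) : Set ℓ where
  var       : Fin m → Term ℓ m
  _∧ᵗ_ _∨ᵗ_ : Term ℓ m → Term ℓ m → Term ℓ m
  _*ᵗ _′ᵗ   : Term ℓ m → Term ℓ m
  0ᵗ 1ᵗ     : Term ℓ m

-- An `Algebra` obeys no identities, so syntactic equality serves. `Operations` instantiated here
-- yields `core` and `⋀δ` as terms.
termAlgebra : (ℓ : Level) → ℕ → Algebra ℓ
termAlgebra ℓ m = record
  { Carrier       = Term ℓ m
  ; _≈_           = _≡_
  ; _∧_           = _∧ᵗ_
  ; _∨_           = _∨ᵗ_
  ; _*            = _*ᵗ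
  ; _′            = _′ᵗ
  ; 0#            = 0ᵗ
  ; 1#            = 1ᵗ
  ; isEquivalence = ≡.isEquivalence
  ; ∧-cong        = ≡.cong₂ _∧ᵗ_
  ; ∨-cong        = ≡.cong₂ _∨ᵗ_
  ; *-cong        = ≡.cong _*ᵗ
  ; ′-cong        = ≡.cong _′ᵗ
  }

module Evaluation (A : Algebra ℓ) where
  open Algebra A
  open Operations A
  open Setoid setoid using (refl; reflexive; sym; trans)

  ⟦_⟧ : Term ℓ m → (Fin m → Carrier) → Carrier
  ⟦ var i ⟧  ρ = ρ i
  ⟦ s ∧ᵗ t ⟧ ρ = ⟦ s ⟧ ρ ∧ ⟦ t ⟧ ρ
  ⟦ s ∨ᵗ t ⟧ ρ = ⟦ s ⟧ ρ ∨ ⟦ t ⟧ ρ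
  ⟦ t *ᵗ ⟧   ρ = ⟦ t ⟧ ρ *
  ⟦ t ′ᵗ ⟧   ρ = ⟦ t ⟧ ρ ′
  ⟦ 0ᵗ ⟧     ρ = 0#
  ⟦ 1ᵗ ⟧     ρ = 1#

  Solves : (Fin m → Carrier) → Pred (Term ℓ m × Term ℓ m) ℓ
  Solves ρ (s , t) = ⟦ s ⟧ ρ ≈ ⟦ t ⟧ ρ

  ⟦⟧-cong : (t : Term ℓ m) {ρ σ : Fin m → Carrier} →
            (∀ i → ρ i ≈ σ i) → ⟦ t ⟧ ρ ≈ ⟦ t ⟧ σ
  ⟦⟧-cong (var i)  p = p i
  ⟦⟧-cong (s ∧ᵗ t) p = ∧-cong (⟦⟧-cong s p) (⟦⟧-cong t p)
  ⟦⟧-cong (s ∨ᵗ t) p = ∨-cong (⟦⟧-cong s p) (⟦⟧-cong t p)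
  ⟦⟧-cong (t *ᵗ)   p = *-cong (⟦⟧-cong t p)
  ⟦⟧-cong (t ′ᵗ)   p = ′-cong (⟦⟧-cong t p)
  ⟦⟧-cong 0ᵗ       p = refl
  ⟦⟧-cong 1ᵗ       p = refl

  module _ {m : ℕ} where
    private
      module 𝕋 = Operations (termAlgebra ℓ m)
      open Algebra (termAlgebra ℓ m) using () renaming (_^[_′*] to _^ᵗ[_′*])

    -- Evaluation passes through a fixed term such as `δ` by computation; the iteration depends on a
    -- variable `n` and takes an induction.
    ⟦⟧-^ : ∀ n (t : Term ℓ m) ρ → ⟦ t ^ᵗ[ n ′*] ⟧ ρ ≡ ⟦ t ⟧ ρ ^[ n ′*]
    ⟦⟧-^ zero    t ρ = ≡.refl
    ⟦⟧-^ (suc n) t ρ = ≡.cong (λ x → x ′ *) (⟦⟧-^ n t ρ)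

    ⟦⟧-core : ∀ n (t : Term ℓ m) ρ → ⟦ 𝕋.core n t ⟧ ρ ≡ core n (⟦ t ⟧ ρ)
    ⟦⟧-core n t ρ = ⟦⟧-^ n (t ∧ᵗ t ′ᵗ *ᵗ) ρ

    -- Congruence alone replaces each right side by the left one, so this applies to an algebra of
    -- `V K` before any law of `M n` is established there.
    ⟦⋀δ⟧-diagonal : ∀ {ρ} {eqs : List (Term ℓ m × Term ℓ m)} → All (Solves ρ) eqs →
                    ⟦ 𝕋.⋀δ eqs ⟧ ρ ≈ ⟦ 𝕋.⋀δ (map (λ eq → proj₁ eq , proj₁ eq) eqs) ⟧ ρ
    ⟦⋀δ⟧-diagonal []       = refl
    ⟦⋀δ⟧-diagonal (p ∷ ps) = ∧-cong (δ-congˡ (sym p)) (⟦⋀δ⟧-diagonal ps)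

    module _ {n : ℕ} (isM : M n A) where
      open PseudocomplementedDeMorgan A (M.isPseudocomplementedDeMorgan isM)
      open RegularStable A isM

      ⟦⋀δ-diagonal⟧≈1 : ∀ {X : Set ℓ} (s : X → Term ℓ m) xs ρ →
                        ⟦ 𝕋.⋀δ (map (λ x → s x , s x) xs) ⟧ ρ ≈ 1#
      ⟦⋀δ-diagonal⟧≈1 s []       ρ = refl
      ⟦⋀δ-diagonal⟧≈1 s (x ∷ xs) ρ =
        trans (∧-cong (δ-refl (⟦ s x ⟧ ρ)) (⟦⋀δ-diagonal⟧≈1 s xs ρ)) (1∧x≈x 1#)

      ⟦⋀δ⟧≈1⇒solves : ∀ eqs ρ → ⟦ 𝕋.⋀δ eqs ⟧ ρ ≈ 1# → All (Solves ρ) eqs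
      ⟦⋀δ⟧≈1⇒solves []        ρ p = []
      ⟦⋀δ⟧≈1⇒solves (_ ∷ eqs) ρ p =
        δ≈1⇒≈ (x∧y≈1⇒x≈1 p) ∷ ⟦⋀δ⟧≈1⇒solves eqs ρ (x∧y≈1⇒y≈1 p)

open Evaluation
  using (Solves; ⟦⟧-cong; ⟦⟧-core; ⟦⋀δ⟧-diagonal; ⟦⋀δ-diagonal⟧≈1; ⟦⋀δ⟧≈1⇒solves)

eval : (A : Algebra ℓ) → Term ℓ m → (Fin m → Algebra.Carrier A) → Algebra.Carrier A
eval A = Evaluation.⟦_⟧ A

-- Homomorphisms, kernels and images.

module _ {f : Algebra.Carrier A → Algebra.Carrier B} (hom : IsHomomorphism A B f) where
  open IsHomomorphism hom
  open Algebra B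
  open Setoid setoid using (refl; sym; trans)

  eval-homo : (t : Term _ m) (ρ : Fin m → Algebra.Carrier A) →
              f (eval A t ρ) ≈ eval B t (f ∘ ρ)
  eval-homo (var i)  ρ = refl
  eval-homo (s ∧ᵗ t) ρ = trans (∧-homo _ _) (∧-cong (eval-homo s ρ) (eval-homo t ρ))
  eval-homo (s ∨ᵗ t) ρ = trans (∨-homo _ _) (∨-cong (eval-homo s ρ) (eval-homo t ρ))
  eval-homo (t *ᵗ)   ρ = trans (*-homo _) (*-cong (eval-homo t ρ))
  eval-homo (t ′ᵗ)   ρ = trans (′-homo _) (′-cong (eval-homo t ρ))
  eval-homo 0ᵗ       ρ = 0-homo
  eval-homo 1ᵗ       ρ = 1-homo

  solves-image : {ρ : Fin m → Algebra.Carrier A} (s t : Term _ m) →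
                 Solves A ρ (s , t) → Solves B (f ∘ ρ) (s , t)
  solves-image s t p = trans (sym (eval-homo s _)) (trans (cong p) (eval-homo t _))

  image-solves : {ρ : Fin m → Algebra.Carrier A} (s t : Term _ m) →
                 Solves B (f ∘ ρ) (s , t) → f (eval A s ρ) ≈ f (eval A t ρ)
  image-solves s t p = trans (eval-homo s _) (trans p (sym (eval-homo t _)))

  kernel : IsCongruence A (λ x y → f x ≈ f y)
  kernel = record
    { reflexive     = cong
    ; isEquivalence = record { refl = refl ; sym = sym ; trans = trans }
    ; ∧-compatible  = λ p q → trans (∧-homo _ _) (trans (∧-cong p q) (sym (∧-homo _ _)))
    ; ∨-compatible  = λ p q → trans (∨-homo _ _) (trans (∨-cong p q) (sym (∨-homo _ _)))
    ; *-compatible  = λ p → trans (*-homo _) (trans (*-cong p) (sym (*-homo _)))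
    ; ′-compatible  = λ p → trans (′-homo _) (trans (′-cong p) (sym (′-homo _)))
    }

  image : Subuniverse B
  image = record
    { Member   = λ y → ∃ λ x → f x ≈ y
    ; resp     = λ y≈z (x , p) → x , trans p y≈z
    ; ∧-closed = λ (x , p) (y , q) → _ , trans (∧-homo x y) (∧-cong p q)
    ; ∨-closed = λ (x , p) (y , q) → _ , trans (∨-homo x y) (∨-cong p q)
    ; *-closed = λ (x , p) → _ , trans (*-homo x) (*-cong p)
    ; ′-closed = λ (x , p) → _ , trans (′-homo x) (′-cong p)
    ; 0-closed = _ , 0-homo
    ; 1-closed = _ , 1-homo
    }

  injective⇒≅image : Injective (Algebra._≈_ A) _≈_ f → A ≅ subalgebra B image
  injective⇒≅image inj =
      (λ x → f x , x , refl)
    , record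
      { cong   = cong
      ; ∧-homo = ∧-homo
      ; ∨-homo = ∨-homo
      ; *-homo = *-homo
      ; ′-homo = ′-homo
      ; 0-homo = 0-homo
      ; 1-homo = 1-homo
      }
    , inj
    , λ (y , x , p) → x , λ z≈x → trans (cong z≈x) p

  -- A total kernel would identify the images of 0 and 1.
  simple⇒injective : Simple A → ¬ 0# ≈ 1# → Injective (Algebra._≈_ A) _≈_ f
  simple⇒injective simple 0≉1 {x} {y} with Simple.Δ-or-∇ simple _ kernel
  ... | inj₁ Δ = Δ x y
  ... | inj₂ ∇ = contradiction (trans (sym 0-homo) (trans (∇ _ _) 1-homo)) 0≉1

inclusion-isHomomorphism : (U : Subuniverse A) → IsHomomorphism (subalgebra A U) A proj₁
inclusion-isHomomorphism {A = A} U = record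
  { cong   = id
  ; ∧-homo = λ _ _ → refl
  ; ∨-homo = λ _ _ → refl
  ; *-homo = λ _ → refl
  ; ′-homo = λ _ → refl
  ; 0-homo = refl
  ; 1-homo = refl
  }
  where open Setoid (Algebra.setoid A) using (refl)

projection-isHomomorphism : {I : Set ℓ} (B : I → Algebra ℓ) (i : I) →
                            IsHomomorphism (product I B) (B i) (λ x → x i)
projection-isHomomorphism B i = record
  { cong   = λ p → p i
  ; ∧-homo = λ _ _ → refl
  ; ∨-homo = λ _ _ → refl
  ; *-homo = λ _ → refl
  ; ′-homo = λ _ → refl
  ; 0-homo = refl
  ; 1-homo = refl
  }
  where open Setoid (Algebra.setoid (B i)) using (refl)

-- `θ` takes `X` as a further reason to identify any two elements. If `θ` is equality, a proof of
-- `X` would identify the distinct `x` and `y`; if it is total, relating them can only be due to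
-- `X`.
simple⇒excludedMiddle : {A : Algebra ℓ} → Simple A → ExcludedMiddle ℓ
simple⇒excludedMiddle {A = A} simple {X}
  with Simple.nontrivial simple | Simple.Δ-or-∇ simple θ isCongruence
  where
  open Algebra A
  open Setoid setoid using (refl; sym; trans)

  θ : Carrier → Carrier → Set _
  θ x y = x ≈ y ⊎ X

  lift₁ : ∀ {x y u v} → (x ≈ y → u ≈ v) → θ x y → θ u v
  lift₁ f = [ inj₁ ∘ f , inj₂ ]′

  lift₂ : ∀ {x y z t u v} → (x ≈ y → z ≈ t → u ≈ v) → θ x y → θ z t → θ u v
  lift₂ f p q = [ (λ p → lift₁ (f p) q) , inj₂ ]′ p

  isCongruence : IsCongruence A θ
  isCongruence = record
    { reflexive     = inj₁
    ; isEquivalence = record { refl = inj₁ refl ; sym = lift₁ sym ; trans = lift₂ trans }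
    ; ∧-compatible  = lift₂ ∧-cong
    ; ∨-compatible  = lift₂ ∨-cong
    ; *-compatible  = lift₁ *-cong
    ; ′-compatible  = lift₁ ′-cong
    }
... | x , y , x≉y | inj₁ Δ = no (x≉y ∘ Δ x y ∘ inj₂)
... | x , y , x≉y | inj₂ ∇ = [ (λ x≈y → contradiction x≈y x≉y) , yes ]′ (∇ x y)

-- Identities in the generated variety.

Separates : (A : Algebra ℓ) (s t : Term ℓ m) → Set ℓ
Separates A s t = ∃ λ ρ → ¬ Solves A ρ (s , t)

module _ {K : Pred (Algebra ℓ) k} (em : ExcludedMiddle ℓ) where

  -- Preservation of identities under H, S and P, read contrapositively so that it delivers a member
  -- of `K` and an assignment. A failing assignment is lifted along a surjection, included from a
  -- subalgebra, or projected to a coordinate.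
  separating-member : V K A → (s t : Term ℓ m) → Separates A s t →
                      ∃ λ B → K B × Separates B s t
  separating-member (base A∈K) s t sep = _ , A∈K , sep
  separating-member (H {A} {B} v (f , hom , surj)) s t (ρ , ρ≉) =
    separating-member v s t (σ , λ p → ρ≉ (begin
      eval B s ρ        ≈⟨ ⟦⟧-cong B s fσ≈ρ ⟨
      eval B s (f ∘ σ)  ≈⟨ solves-image hom s t p ⟩
      eval B t (f ∘ σ)  ≈⟨ ⟦⟧-cong B t fσ≈ρ ⟩
      eval B t ρ        ∎))
    where
    open ≈-Reasoning (Algebra.setoid B)
    σ : Fin _ → Algebra.Carrier A
    σ i = proj₁ (surj (ρ i))
    fσ≈ρ : ∀ i → Algebra._≈_ B (f (σ i)) (ρ i)
    fσ≈ρ i = proj₂ (surj (ρ i)) (Setoid.refl (Algebra.setoid A))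
  separating-member (S v U) s t (ρ , ρ≉) =
    separating-member v s t
      (proj₁ ∘ ρ , ρ≉ ∘ image-solves (inclusion-isHomomorphism U) s t)
  separating-member (P I B v) s t (ρ , ρ≉)
    -- Failure in a product only denies agreement at all coordinates; excluded middle produces one
    -- where the sides differ.
    with em {∃ λ i → ¬ Solves (B i) (λ j → ρ j i) (s , t)}
  ... | yes (i , ρi≉) = separating-member (v i) s t (_ , ρi≉)
  ... | no ∄i = contradiction
    (λ i → image-solves (projection-isHomomorphism B i) s t
             (em⇒dne em (λ ρi≉ → ∄i (i , ρi≉))))
    ρ≉

  identity : V K A → (s t : Term ℓ m) → (∀ {B} → K B → ∀ ρ → Solves B ρ (s , t)) →
             ∀ ρ → Solves A ρ (s , t)
  identity A∈V s t K⊨ ρ = em⇒dne em λ ρ≉ →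
    let _ , B∈K , σ , σ≉ = separating-member A∈V s t (ρ , ρ≉) in σ≉ (K⊨ B∈K σ)

  solution-in-member : ∀ {n} → K ⊆ M n ∩ Simple → V K A →
                       (eqs : List (Term ℓ m × Term ℓ m)) →
                       ∀ {ρ i j} → All (Solves A ρ) eqs → ¬ Solves A ρ (var i , var j) →
                       ∃ λ B → K B × ∃ λ σ → All (Solves B σ) eqs
  solution-in-member {A} {m} {n} K⊆ A∈V eqs {ρ} {i} {j} sol ρi≉ρj =
    let B , B∈K , σ , σ≉ = separating-member A∈V (T ∧ᵗ var i) (T ∧ᵗ var j)
          (ρ , λ p → ρi≉ρj (trans (sym (T∧var i)) (trans p (T∧var j))))
    in B , B∈K , σ , solves B∈K σ≉
    where
    open Setoid (Algebra.setoid A) using (refl; sym; trans; reflexive)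
    module 𝕋 = Operations (termAlgebra ℓ m)

    tautologies : List (Term ℓ m × Term ℓ m)
    tautologies = map (λ eq → proj₁ eq , proj₁ eq) eqs

    -- `T′` is 1 throughout `K`, so `T′ ∧ᵗ var l = var l` is an identity of `K` and passes to `A`.
    -- At `ρ` it also holds for `T`, which has the same value there.
    T T′ : Term ℓ m
    T  = 𝕋.core n (𝕋.⋀δ eqs)
    T′ = 𝕋.core n (𝕋.⋀δ tautologies)

    T≈T′ : Solves A ρ (T , T′)
    T≈T′ = trans (reflexive (⟦⟧-core A n (𝕋.⋀δ eqs) ρ))
          (trans (Operations.core-cong A n (⟦⋀δ⟧-diagonal A sol))
                 (sym (reflexive (⟦⟧-core A n (𝕋.⋀δ tautologies) ρ))))

    T′∧var : ∀ {B} → K B → ∀ l σ → Solves B σ (T′ ∧ᵗ var l , var l)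
    T′∧var {B} B∈K l σ = begin
      eval B T′ σ ∧ σ l
        ≡⟨ ≡.cong (_∧ σ l) (⟦⟧-core B n (𝕋.⋀δ tautologies) σ) ⟩
      core n (eval B (𝕋.⋀δ tautologies) σ) ∧ σ l
        ≈⟨ ∧-cong (x≈1⇒core≈1 n (⟦⋀δ-diagonal⟧≈1 B isM proj₁ eqs σ)) B.refl ⟩
      1# ∧ σ l
        ≈⟨ 1∧x≈x (σ l) ⟩
      σ l ∎
      where
      isM = proj₁ (K⊆ B∈K)
      open Algebra B
      open Operations B
      open PseudocomplementedDeMorgan B (M.isPseudocomplementedDeMorgan isM)
      module B = Setoid setoid
      open ≈-Reasoning setoid

    T∧var : ∀ l → Solves A ρ (T ∧ᵗ var l , var l)
    T∧var l = trans (Algebra.∧-cong A T≈T′ refl)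
                    (identity A∈V (T′ ∧ᵗ var l) (var l) (λ B∈K → T′∧var B∈K l) ρ)

    -- If the core were 0, both sides would be 0 and agree at `σ`. So it is nonzero, and simplicity
    -- makes the meet of all `δ` equal to 1.
    solves : ∀ {B σ} → K B → ¬ Solves B σ (T ∧ᵗ var i , T ∧ᵗ var j) → All (Solves B σ) eqs
    solves {B} {σ} B∈K σ≉ = ⟦⋀δ⟧≈1⇒solves B isM eqs σ
      (core≉0⇒x≈1 (proj₂ (K⊆ B∈K)) λ core≈0 → σ≉ (begin
        eval B T σ ∧ σ i  ≈⟨ vanishes core≈0 i ⟩
        0#                ≈⟨ vanishes core≈0 j ⟨
        eval B T σ ∧ σ j  ∎))
      where
      isM = proj₁ (K⊆ B∈K)
      open Algebra B
      open Operations B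
      open PseudocomplementedDeMorgan B (M.isPseudocomplementedDeMorgan isM)
      open RegularStable B isM
      module B = Setoid setoid
      open ≈-Reasoning setoid
      vanishes : core n (eval B (𝕋.⋀δ eqs) σ) ≈ 0# → ∀ l → eval B T σ ∧ σ l ≈ 0#
      vanishes core≈0 l = begin
        eval B T σ ∧ σ l                    ≡⟨ ≡.cong (_∧ σ l) (⟦⟧-core B n (𝕋.⋀δ eqs) σ) ⟩
        core n (eval B (𝕋.⋀δ eqs) σ) ∧ σ l  ≈⟨ ∧-cong core≈0 B.refl ⟩
        0# ∧ σ l                            ≈⟨ 0∧x≈0 (σ l) ⟩
        0#                                  ∎

-- The operation tables are cut into blocks, one for each pair (i , j), so that
-- one nested traversal covers operations of every arity; the equations for
-- constants and unary operations recur.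

module Diagram (A : Algebra ℓ) (finite : Finite A) where
  open Algebra A
  open Setoid setoid using (refl; sym; trans)
  open Bijection (proj₂ finite) using (to; injective; strictlySurjective)

  size : ℕ
  size = proj₁ finite

  index : Carrier → Fin size
  index x = proj₁ (strictlySurjective x)

  to-index : ∀ x → to (index x) ≈ x
  to-index x = proj₂ (strictlySurjective x)

  -- Indices are chosen separately for each element; injectivity of `to` makes the choice
  -- independent of the representative.
  index-cong : ∀ {x y} → x ≈ y → index x ≡ index y
  index-cong {x} {y} x≈y = injective (trans (to-index x) (trans x≈y (sym (to-index y))))

  element : Carrier → Term ℓ size
  element x = var (index x)

  tables : Fin size → Fin size → List (Term ℓ size × Term ℓ size)
  tables i j =
      (0ᵗ , element 0#)
    ∷ (1ᵗ , element 1#)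
    ∷ (var i *ᵗ , element (to i *))
    ∷ (var i ′ᵗ , element (to i ′))
    ∷ (var i ∧ᵗ var j , element (to i ∧ to j))
    ∷ (var i ∨ᵗ var j , element (to i ∨ to j))
    ∷ []

  row : Fin size → List (Term ℓ size × Term ℓ size)
  row i = concat (tabulate (tables i))

  diagram : List (Term ℓ size × Term ℓ size)
  diagram = concat (tabulate row)

  to-solves : All (Solves A to) diagram
  to-solves = concat⁺ (tabulate⁺ {f = row} λ i →
                concat⁺ (tabulate⁺ {f = tables i} (to-solves-tables i)))
    where
    to-solves-tables : ∀ i j → All (Solves A to) (tables i j)
    to-solves-tables i j =
        sym (to-index 0#)
      ∷ sym (to-index 1#)
      ∷ sym (to-index (to i *))
      ∷ sym (to-index (to i ′))
      ∷ sym (to-index (to i ∧ to j))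
      ∷ sym (to-index (to i ∨ to j))
      ∷ []

  to-distinguishes : ∀ {x y} → ¬ x ≈ y → ¬ Solves A to (element x , element y)
  to-distinguishes {x} {y} x≉y p = x≉y (trans (sym (to-index x)) (trans p (to-index y)))

  solution-isHomomorphism : ∀ {ρ} → All (Solves B ρ) diagram → IsHomomorphism A B (ρ ∘ index)
  solution-isHomomorphism {B = B} {ρ} sol = record
    { cong   = λ x≈y → B.reflexive (≡.cong ρ (index-cong x≈y))
    ; ∧-homo = ∧-homo
    ; ∨-homo = ∨-homo
    ; *-homo = *-homo
    ; ′-homo = ′-homo
    ; 0-homo = 0-homo
    ; 1-homo = 1-homo
    }
    where
    module B where
      open Algebra B public
      open Setoid (Algebra.setoid B) public using (refl; sym; trans; reflexive)

    solves-tables : ∀ x y → All (Solves B ρ) (tables (index x) (index y))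
    solves-tables x y = tabulate⁻ (concat⁻ row-x) (index y)
      where
      row-x : All (Solves B ρ) (row (index x))
      row-x = tabulate⁻ {f = row} (concat⁻ sol) (index x)

    -- The tables speak of `to (index x)` rather than `x`; this carries an entry across the equality
    -- `to-index`.
    at-element : ∀ {x y z} → x ≈ y → z B.≈ ρ (index y) → ρ (index x) B.≈ z
    at-element x≈y p = B.trans (B.reflexive (≡.cong ρ (index-cong x≈y))) (B.sym p)

    0-homo : ρ (index 0#) B.≈ B.0#
    -- Every block contains the equations for the constants; `0#` supplies an index, so that a block
    -- exists.
    0-homo with p ∷ _ ← solves-tables 0# 0# = B.sym p

    1-homo : ρ (index 1#) B.≈ B.1#
    1-homo with _ ∷ p ∷ _ ← solves-tables 0# 0# = B.sym p

    *-homo : ∀ x → ρ (index (x *)) B.≈ ρ (index x) B.*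
    *-homo x with _ ∷ _ ∷ p ∷ _ ← solves-tables x x = at-element (*-cong (sym (to-index x))) p

    ′-homo : ∀ x → ρ (index (x ′)) B.≈ ρ (index x) B.′
    ′-homo x with _ ∷ _ ∷ _ ∷ p ∷ _ ← solves-tables x x = at-element (′-cong (sym (to-index x))) p

    ∧-homo : ∀ x y → ρ (index (x ∧ y)) B.≈ ρ (index x) B.∧ ρ (index y)
    ∧-homo x y with _ ∷ _ ∷ _ ∷ _ ∷ p ∷ _ ← solves-tables x y =
      at-element (∧-cong (sym (to-index x)) (sym (to-index y))) p

    ∨-homo : ∀ x y → ρ (index (x ∨ y)) B.≈ ρ (index x) B.∨ ρ (index y)
    ∨-homo x y with _ ∷ _ ∷ _ ∷ _ ∷ _ ∷ p ∷ _ ← solves-tables x y =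
      at-element (∨-cong (sym (to-index x)) (sym (to-index y))) p

-- Embedding a finite simple algebra into a member of `K`.

theorem5p1 : ∀ {ℓ k : Level} (n : ℕ) (K : Pred (Algebra ℓ) k) →
    K ⊆ M n ∩ Simple →
    LocallyFinite (V K) →
    (A : Algebra ℓ) → V K A → Finite A → Simple A →
    ∃ λ B → K B × ∃ λ (U : Subuniverse B) → A ≅ subalgebra B U
theorem5p1 n K K⊆ _ A A∈V finite simple =
  let x , y , x≉y = Simple.nontrivial simple
      -- Excluded middle comes from the simplicity of `A`, and the variables naming `x` and `y`
      -- serve as the distinguished pair.
      B , B∈K , ρ , sol = solution-in-member (simple⇒excludedMiddle simple) K⊆ A∈V
        diagram to-solves (to-distinguishes x≉y)
      isM , B-simple = K⊆ B∈K
      hom = solution-isHomomorphism sol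
      0≉1 = PseudocomplementedDeMorgan.simple⇒0≉1 B (M.isPseudocomplementedDeMorgan isM) B-simple
  in B , B∈K , image hom , injective⇒≅image hom (simple⇒injective hom simple 0≉1)
  where open Diagram A finite
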